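{- Let $f=\frac{1}{2^{6M-1}}P(x_1,\dots,x_{3M})\,Q(x_1,\dots,x_{3M})-1$ be the elementary algebraic expression of an identity relaxed logical formula, with CNF part $P$ and IOR part $Q$. By replacing $x_i$ in the IOR part by $\frac1{x_i}$ for all $i$, the idempotent law $x_i^2=1$ can be calculated by elementary algebra: every product of an $x_i$ from the CNF part with an $x_i$ from the IOR part, which the idempotent law turns into $1$, becomes $x_i\cdot\frac{1}{x_i}=1$. The constant term obtained by this identity relaxation by inverse element equals the constant term obtained by the idempotent law; that is, the constant term of the Laurent polynomial $$\frac{1}{2^{6M-1}}P(x_1,\dots,x_{3M})\,Q\!\left(\tfrac1{x_1},\dots,\tfrac1{x_{3M}}\right)-1$$ equals the constant term of the polynomial obtained by expanding $f$ and replacing every $x_i^2$ by $1$.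
   Context: Given a CNF formula with $M$ clauses of three literals each and $N$ variables $X_1,\dots,X_N$ (each occurring $r_i\ge1$ times), number the literal occurrences $1,\dots,3M$ (clause $c$ consists of occurrences $3c-2,3c-1,3c$), replace the $a$-th occurrence (positive or negated) by a new variable $x_a$, let $x_{ij}$ be the new variable of the $j$-th occurrence of $X_i$, and $e_{ij}=1$ or $-1$ according to whether that occurrence is positive or negative. The elementary algebraic expression of the identity relaxed logical formula is $f=\frac{1}{2^{6M-1}}PQ-1$ with $$P=\prod_{c=1}^{M}\bigl((x_{3c-2}-1)(x_{3c-1}-1)(x_{3c}-1)+8\bigr),\qquad Q=\prod_{i=1}^{N}\Bigl(\prod_{j=1}^{r_i}(e_{ij}x_{ij}+1)+\prod_{j=1}^{r_i}(-e_{ij}x_{ij}+1)\Bigr).$$ Replacing $x_i$ by $1/x_i$ for all $i$ in the IOR part is called the identity relaxation by inverse element. The constant term of a Laurent polynomial is the coefficient of the monomial $1$ in its expansion. -}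

module Defs where

open import Data.Bool.Base using (if_then_else_)
open import Data.Fin.Base using (Fin; combine; remQuot)
open import Data.Fin.Patterns using (0F; 1F; 2F)
import Data.Fin.Properties as Fin
open import Data.Integer.Base as ℤ using (ℤ; +_)
import Data.Integer.Properties as ℤ
open import Data.List.Base using (List; []; _∷_; _++_; map; cartesianProductWith; filter; allFin; length; lookup)
open import Data.Nat.Base as ℕ using (ℕ; zero; suc)
import Data.Nat.Properties as ℕ
open import Data.Product.Base using (_×_; _,_; proj₁; proj₂)
open import Data.Rational.Base as ℚ using (ℚ; 0ℚ; 1ℚ)
open import Data.Vec.Base as Vec using (Vec)
import Data.Vec.Functional as Vector
open import Data.Vec.Properties using (≡-dec)
open import Relation.Binary.Definitions using (DecidableEquality)
open import Relation.Binary.PropositionalEquality.Core using (_≡_)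
open import Relation.Nullary.Decidable.Core using (does)

-- An element of the monoid algebra ℚ[Eⁿ], written as a finite formal sum of
-- terms.  Like terms are not collected and the order of the terms is
-- irrelevant: two sums are identified (_≈_ below) when, for every monomial,
-- their total coefficients agree.
FormalSum : Set → ℕ → Set
FormalSum E n = List (ℚ × Vec E n)

mapExponents : ∀ {E F : Set} {n} → (E → F) → FormalSum E n → FormalSum F n
mapExponents g = map (λ t → proj₁ t , Vec.map g (proj₂ t))

module Algebra {E : Set} (_⊕_ : E → E → E) (0E : E) (_≟_ : DecidableEquality E) where

  infix  4 _≈_
  infixl 6 _+_
  infixl 7 _*_

  one : ∀ {n} → Vec E n
  one = Vec.replicate _ 0E

  coeff : ∀ {n} → Vec E n → FormalSum E n → ℚ
  coeff m []             = 0ℚ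
  coeff m ((c , m′) ∷ p) = (if does (≡-dec _≟_ m′ m) then c else 0ℚ) ℚ.+ coeff m p

  constantTerm : ∀ {n} → FormalSum E n → ℚ
  constantTerm = coeff one

  _≈_ : ∀ {n} → FormalSum E n → FormalSum E n → Set
  p ≈ q = ∀ m → coeff m p ≡ coeff m q

  const : ∀ {n} → ℚ → FormalSum E n
  const c = (c , one) ∷ []

  _+_ : ∀ {n} → FormalSum E n → FormalSum E n → FormalSum E n
  p + q = p ++ q

  _*_ : ∀ {n} → FormalSum E n → FormalSum E n → FormalSum E n
  _*_ = cartesianProductWith
    (λ s t → proj₁ s ℚ.* proj₁ t , Vec.zipWith _⊕_ (proj₂ s) (proj₂ t))

  ∏ : ∀ {n k} → (Fin k → FormalSum E n) → FormalSum E n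
  ∏ = Vector.foldr _*_ (const 1ℚ)

module Poly    = Algebra ℕ._+_ 0 ℕ._≟_
module Laurent = Algebra ℤ._+_ (+ 0) ℤ._≟_

Polynomial LaurentPolynomial : ℕ → Set
Polynomial        = FormalSum ℕ
LaurentPolynomial = FormalSum ℤ

X : ∀ {n} → Fin n → Polynomial n
X a = (1ℚ , Poly.one Vec.[ a ]≔ 1) ∷ []

toLaurent : ∀ {n} → Polynomial n → LaurentPolynomial n
toLaurent = mapExponents +_

-- p(x₁,…,xₙ) ↦ p(1/x₁,…,1/xₙ)
atInverses : ∀ {n} → Polynomial n → LaurentPolynomial n
atInverses = mapExponents (λ k → ℤ.- (+ k))

-- Exponent left after replacing x² by 1 as often as possible.
cancelSquares : ℕ → ℕ
cancelSquares 0             = 0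
cancelSquares 1             = 1
cancelSquares (suc (suc k)) = cancelSquares k

idempotentLaw : ∀ {n} → Polynomial n → Polynomial n
idempotentLaw = mapExponents cancelSquares

data Literal (N : ℕ) : Set where
  pos neg : Fin N → Literal N

variableOf : ∀ {N} → Literal N → Fin N
variableOf (pos i) = i
variableOf (neg i) = i

sign : ∀ {N} → Literal N → ℚ
sign (pos _) = 1ℚ
sign (neg _) = ℚ.- 1ℚ

CNF : ℕ → ℕ → Set
CNF M N = Vec (Vec (Literal N) 3) M

module _ {M N : ℕ} (φ : CNF M N) where

  -- Occurrences are numbered clause by clause, from 0: those of clause c are
  -- combine c 0F, combine c 1F, combine c 2F, with values 3c, 3c+1, 3c+2.
  literalAt : Fin (M ℕ.* 3) → Literal N
  literalAt a = Vec.lookup (Vec.lookup φ (proj₁ ck)) (proj₂ ck)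
    where ck = remQuot {M} 3 a

  -- Increasing list of the occurrences of Xᵢ, positive or negated.
  occurrences : Fin N → List (Fin (M ℕ.* 3))
  occurrences i = filter (λ a → variableOf (literalAt a) Fin.≟ i) (allFin (M ℕ.* 3))

  r : Fin N → ℕ
  r i = length (occurrences i)

  occurrence : (i : Fin N) → Fin (r i) → Fin (M ℕ.* 3)
  occurrence i = lookup (occurrences i)

  x : (i : Fin N) → Fin (r i) → Polynomial (M ℕ.* 3)
  x i j = X (occurrence i j)

  e : (i : Fin N) → Fin (r i) → ℚ
  e i j = sign (literalAt (occurrence i j))

  open Poly

  P : Polynomial (M ℕ.* 3)
  P = ∏ λ (c : Fin M) →
        (X (combine c 0F) + const (ℚ.- 1ℚ))
      * (X (combine c 1F) + const (ℚ.- 1ℚ))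
      * (X (combine c 2F) + const (ℚ.- 1ℚ))
      + const (+ 8 ℚ./ 1)

  Q : Polynomial (M ℕ.* 3)
  Q = ∏ λ (i : Fin N) →
        (∏ λ (j : Fin (r i)) → const (e i j) * x i j + const 1ℚ)
      + (∏ λ (j : Fin (r i)) → const (ℚ.- e i j) * x i j + const 1ℚ)

-- 1 / 2^(6M-1), written as 2 / 2^(6M) so that it is also right for M = 0.
scale : ℕ → ℚ
scale M = ℚ._/_ (+ 2) (2 ℕ.^ (6 ℕ.* M)) {{ℕ.m^n≢0 2 (6 ℕ.* M)}}

elementaryExpression : ∀ {M N} → CNF M N → Polynomial (M ℕ.* 3)
elementaryExpression {M} φ = const (scale M) * P φ * Q φ + const (ℚ.- 1ℚ)
  where open Poly

relaxationByInverse : ∀ {M N} → CNF M N → LaurentPolynomial (M ℕ.* 3)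
relaxationByInverse {M} φ =
  const (scale M) * toLaurent (P φ) * atInverses (Q φ) + const (ℚ.- 1ℚ)
  where open Laurent

{-# OPTIONS --safe #-}
-- Every Xᵢ has its own occurrences and every occurrence lies in one clause, so
-- the factors of P, and those of Q, involve disjoint sets of variables.  Hence
-- each monomial u of P and w of Q is squarefree, and for exponents k, l ∈ {0, 1}
-- the condition k − l = 0 is equivalent to k + l being even.  So exactly the same
-- pairs (u , w) contribute to the two constant terms.
module Submission where

open import Defs
open import Data.Bool.Base using (if_then_else_)
open import Data.Empty using (⊥; ⊥-elim)
open import Data.Fin.Base using (Fin; zero; suc; combine)
open import Data.Fin.Patterns using (0F; 1F; 2F)
import Data.Fin.Properties as Fin
open import Data.Integer.Base as ℤ using (ℤ; +_; 0ℤ)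
import Data.Integer.Properties as ℤ
open import Data.List.Base using (List; []; _∷_; allFin; cartesianProductWith; lookup)
open import Data.List.Membership.Propositional.Properties using (∈-lookup)
open import Data.List.Relation.Binary.Pointwise as Pointwise using (Pointwise; []; _∷_)
open import Data.List.Relation.Unary.All as All using (All; []; _∷_)
import Data.List.Relation.Unary.All.Properties as All
open import Data.List.Relation.Unary.AllPairs using ([]; _∷_)
open import Data.List.Relation.Unary.Unique.Propositional using (Unique)
import Data.List.Relation.Unary.Unique.Propositional.Properties as Unique
open import Data.Nat.Base as ℕ using (ℕ; zero; suc; _≤_; _*_)
import Data.Nat.Properties as ℕ
open import Data.Product.Base as Product using (_×_; _,_; proj₁; proj₂; ∃)
open import Data.Rational.Base as ℚ using (ℚ; 0ℚ; 1ℚ)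
open import Data.Sum.Base using (_⊎_; inj₁; inj₂; [_,_])
open import Data.Vec.Base as Vec using (Vec)
open import Data.Vec.Properties
  using (≡-dec; lookup-map; lookup-replicate; lookup-zipWith; lookup∘update; lookup∘update′)
import Data.Vec.Relation.Binary.Pointwise.Extensional as Ext
open import Function.Base using (_∘_; id)
open import Function.Bundles using (_⇔_; mk⇔; module Equivalence)
open import Relation.Binary.PropositionalEquality
  using (_≡_; refl; sym; trans; cong; cong₂; subst; subst₂; setoid)
open import Relation.Nullary.Decidable using (yes; no; does-⇔)
open import Relation.Nullary.Negation using (¬_)

private
  variable
    n k : ℕ
    E : Set

-- Constant vectors and lists without repetition.

≡replicate : {v : Vec E n} {z : E} → (∀ a → Vec.lookup v a ≡ z) → v ≡ Vec.replicate n z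
≡replicate h = Ext.Pointwise-≡⇒≡ (Ext.ext λ a → trans (h a) (sym (lookup-replicate a _)))

≡replicate⁻ : {v : Vec E n} {z : E} → v ≡ Vec.replicate n z → ∀ a → Vec.lookup v a ≡ z
≡replicate⁻ refl a = lookup-replicate a _

Unique⇒lookup-injective : {A : Set} {xs : List A} → Unique xs →
                          ∀ i j → lookup xs i ≡ lookup xs j → i ≡ j
Unique⇒lookup-injective (_ ∷ _)   zero    zero    _  = refl
Unique⇒lookup-injective (x∉ ∷ _)  zero    (suc j) eq = ⊥-elim (All.lookup x∉ (∈-lookup j) eq)
Unique⇒lookup-injective (x∉ ∷ _)  (suc i) zero    eq = ⊥-elim (All.lookup x∉ (∈-lookup i) (sym eq))
Unique⇒lookup-injective (_ ∷ xs!) (suc i) (suc j) eq =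
  cong suc (Unique⇒lookup-injective xs! i j eq)

-- Squarefree formal sums and their supports.

data ExponentIn (S : Set) : ℕ → Set where
  absent  : ExponentIn S 0
  present : S → ExponentIn S 1

ExponentIn-map : {S T : Set} → (S → T) → ∀ {l} → ExponentIn S l → ExponentIn T l
ExponentIn-map f absent      = absent
ExponentIn-map f (present s) = present (f s)

-- Exponent 2 could only arise as 1 + 1, and then both supports would contain the variable.
ExponentIn-+ : {S T : Set} → ¬ (S × T) → ∀ {l m} →
               ExponentIn S l → ExponentIn T m → ExponentIn (S ⊎ T) (l ℕ.+ m)
ExponentIn-+ dis absent      t           = ExponentIn-map inj₂ t
ExponentIn-+ dis (present s) absent      = present (inj₁ s)
ExponentIn-+ dis (present s) (present t) = ⊥-elim (dis (s , t))

ExponentIn⇒≤1 : {S : Set} → ∀ {l} → ExponentIn S l → l ≤ 1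
ExponentIn⇒≤1 absent      = ℕ.z≤n
ExponentIn⇒≤1 (present _) = ℕ.≤-refl

-- The support `S` is carried along because a bound on exponents alone is not preserved by products;
-- disjointness of supports is what preserves it.
SquarefreeIn : (Fin n → Set) → Polynomial n → Set
SquarefreeIn S = All λ t → ∀ a → ExponentIn (S a) (Vec.lookup (proj₂ t) a)

module _ {S T : Fin n → Set} where

  weaken : (∀ a → S a → T a) → ∀ {p} → SquarefreeIn S p → SquarefreeIn T p
  weaken S⊆T = All.map λ s a → ExponentIn-map (S⊆T a) (s a)

  squarefree-* : (∀ a → ¬ (S a × T a)) → ∀ {p q} → SquarefreeIn S p → SquarefreeIn T q →
                 SquarefreeIn (λ a → S a ⊎ T a) (p Poly.* q)
  squarefree-* dis {p} {q} ps qs =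
    All.cartesianProductWith⁺ (setoid _) (setoid _) _ p q λ {s} {t} s∈p t∈q a →
      subst (ExponentIn _) (sym (lookup-zipWith ℕ._+_ a (proj₂ s) (proj₂ t)))
        (ExponentIn-+ (dis a) (All.lookup ps s∈p a) (All.lookup qs t∈q a))

squarefree-+ : {S : Fin n → Set} → ∀ {p q} → SquarefreeIn S p → SquarefreeIn S q →
               SquarefreeIn S (p Poly.+ q)
squarefree-+ = All.++⁺

squarefree-const : {S : Fin n → Set} (c : ℚ) → SquarefreeIn S (Poly.const c)
squarefree-const c = (λ a → subst (ExponentIn _) (sym (lookup-replicate a 0)) absent) ∷ []

squarefree-X : (a : Fin n) → SquarefreeIn (_≡ a) (X a)
squarefree-X a = exponent ∷ []
  where
  exponent : ∀ b → ExponentIn (b ≡ a) (Vec.lookup (Poly.one Vec.[ a ]≔ 1) b)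
  exponent b with b Fin.≟ a
  ... | yes refl = subst (ExponentIn _) (sym (lookup∘update b Poly.one 1)) (present refl)
  ... | no b≢a   = subst (ExponentIn _)
                     (sym (trans (lookup∘update′ b≢a Poly.one 1) (lookup-replicate b 0))) absent

-- Induction on the number of factors: pairwise disjointness separates the first support from the
-- union of the later ones, so `squarefree-*` applies.
squarefree-∏ : {S : Fin k → Fin n → Set} →
               (∀ i j a → S i a → S j a → i ≡ j) →
               ∀ {f} → (∀ i → SquarefreeIn (S i) (f i)) →
               SquarefreeIn (λ a → ∃ λ i → S i a) (Poly.∏ f)
squarefree-∏ {k = zero}  dis fs = squarefree-const 1ℚ
squarefree-∏ {k = suc k} dis fs =
  weaken (λ a → [ (zero ,_) , Product.map suc id ])
    (squarefree-* (λ { a (s , i , t) → Fin.0≢1+n (dis zero (suc i) a s t) })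
      (fs zero)
      (squarefree-∏ (λ i j a s t → Fin.suc-injective (dis (suc i) (suc j) a s t)) (fs ∘ suc)))

squarefree-linear : (c : ℚ) (a : Fin n) (d : ℚ) →
                    SquarefreeIn (_≡ a) (Poly.const c Poly.* X a Poly.+ Poly.const d)
squarefree-linear c a d =
  squarefree-+
    -- The constant gets the empty support, which is disjoint from any other.
    (weaken (λ b → [ ⊥-elim , id ])
      (squarefree-* {S = λ _ → ⊥} (λ _ → proj₁) (squarefree-const c) (squarefree-X a)))
    (squarefree-const d)

-- Squarefreeness of the CNF part and the IOR part.

module _ {M N : ℕ} (φ : CNF M N) where

  open Poly using (const; ∏) renaming (_+_ to _⊞_; _*_ to _⊠_)

  -- Clause `c` is supported on the image of `combine c`. Injectivity of `combine` separates
  -- different clauses, and also the three literals of one clause. The total support is left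
  -- existential, as only the exponent bound matters afterwards.
  P-squarefree : ∃ λ S → SquarefreeIn S (P φ)
  P-squarefree = _ , squarefree-∏ {S = λ c a → ∃ λ l → a ≡ combine c l} disjoint clause
    where
    disjoint : ∀ c d (a : Fin (M * 3)) →
               (∃ λ l → a ≡ combine c l) → (∃ λ m → a ≡ combine d m) → c ≡ d
    disjoint c d a (l , a≡) (m , a≡′) =
      Fin.combine-injectiveˡ c l d m (trans (sym a≡) a≡′)

    different : ∀ (c : Fin M) {l m : Fin 3} → ¬ (l ≡ m) → ∀ {a} → a ≡ combine c l → ¬ (a ≡ combine c m)
    different c {l} {m} l≢m a≡ a≡′ =
      l≢m (Fin.combine-injectiveʳ c l c m (trans (sym a≡) a≡′))

    factor : ∀ (c : Fin M) (l : Fin 3) →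
             SquarefreeIn (_≡ combine c l) (X (combine c l) ⊞ const (ℚ.- 1ℚ))
    factor c l = squarefree-+ (squarefree-X (combine c l)) (squarefree-const _)

    clause : ∀ (c : Fin M) → SquarefreeIn (λ a → ∃ λ l → a ≡ combine c l) _
    clause c = squarefree-+
      (weaken (λ a → [ [ (0F ,_) , (1F ,_) ] , (2F ,_) ])
        (squarefree-*
          (λ { a (inj₁ p , q) → different c (λ ()) p q
             ; a (inj₂ p , q) → different c (λ ()) p q })
          (squarefree-* (λ { a (p , q) → different c (λ ()) p q }) (factor c 0F) (factor c 1F))
          (factor c 2F)))
      (squarefree-const _)

  variableOf-occurrence : ∀ i j → variableOf (literalAt φ (occurrence φ i j)) ≡ i
  variableOf-occurrence i j =
    All.lookup (All.all-filter (λ a → variableOf (literalAt φ a) Fin.≟ i) (allFin (M * 3)))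
      (∈-lookup j)

  occurrence-injective : ∀ i j j′ → occurrence φ i j ≡ occurrence φ i j′ → j ≡ j′
  occurrence-injective i =
    Unique⇒lookup-injective
      (Unique.filter⁺ (λ a → variableOf (literalAt φ a) Fin.≟ i) (Unique.allFin⁺ (M * 3)))

  Q-squarefree : ∃ λ S → SquarefreeIn S (Q φ)
  Q-squarefree = _ , squarefree-∏ {S = λ i a → variableOf (literalAt φ a) ≡ i}
    (λ i j a p q → trans (sym p) q)
    -- The two products share their support, which is harmless because they are added, not
    -- multiplied.
    (λ i → squarefree-+ (one-sign i (e φ i)) (one-sign i (λ j → ℚ.- e φ i j)))
    where
    one-sign : ∀ i (s : Fin (r φ i) → ℚ) →
               SquarefreeIn (λ a → variableOf (literalAt φ a) ≡ i)
                 (∏ λ j → const (s j) ⊠ x φ i j ⊞ const 1ℚ)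
    one-sign i s =
      -- Inside the product, occurrences of one variable are told apart by position; outside, only
      -- their common variable is remembered.
      weaken (λ { a (j , refl) → variableOf-occurrence i j })
        (squarefree-∏ {S = λ j a → a ≡ occurrence φ i j}
          (λ j j′ a p q → occurrence-injective i j j′ (trans (sym p) q))
          (λ j → squarefree-linear (s j) (occurrence φ i j) 1ℚ))

-- Termwise comparison of Laurent and ordinary formal sums.

Correspondence : Set₁
Correspondence = ℤ → ℕ → Set

infix 4 _~[_]_

-- Changing exponents by a map and forming products as lists of pairs both keep the order of terms,
-- so the two expansions can be matched position by position without collecting like terms.
_~[_]_ : LaurentPolynomial n → Correspondence → Polynomial n → Set
p ~[ ρ ] q = Pointwise
  (λ s t → proj₁ s ≡ proj₁ t × (∀ a → ρ (Vec.lookup (proj₂ s) a) (Vec.lookup (proj₂ t) a))) p q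

cartesianProductWith⁺ : {A A′ B B′ C C′ : Set}
  {R : A → A′ → Set} {S : B → B′ → Set} {T : C → C′ → Set}
  {f : A → B → C} {g : A′ → B′ → C′} →
  (∀ {x x′ y y′} → R x x′ → S y y′ → T (f x y) (g x′ y′)) →
  ∀ {xs xs′ ys ys′} → Pointwise R xs xs′ → Pointwise S ys ys′ →
  Pointwise T (cartesianProductWith f xs ys) (cartesianProductWith g xs′ ys′)
cartesianProductWith⁺ h []       ss = []
cartesianProductWith⁺ h (r ∷ rs) ss =
  Pointwise.++⁺ (Pointwise.map⁺ _ _ (Pointwise.map (h r) ss)) (cartesianProductWith⁺ h rs ss)

module _ (ρ σ τ : Correspondence) where

  ~-* : (∀ {i l j m} → ρ i l → σ j m → τ (i ℤ.+ j) (l ℕ.+ m)) →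
        ∀ {p q : LaurentPolynomial n} {p′ q′} → p ~[ ρ ] p′ → q ~[ σ ] q′ →
        p Laurent.* q ~[ τ ] p′ Poly.* q′
  ~-* h = cartesianProductWith⁺ λ { {s} {s′} {t} {t′} (c≡ , ρs) (d≡ , σt) →
    cong₂ ℚ._*_ c≡ d≡ , λ a →
      subst₂ τ (sym (lookup-zipWith ℤ._+_ a (proj₂ s) (proj₂ t)))
               (sym (lookup-zipWith ℕ._+_ a (proj₂ s′) (proj₂ t′)))
               (h (ρs a) (σt a)) }

~-const : (ρ : Correspondence) → ρ 0ℤ 0 → (c : ℚ) →
          Laurent.const {n} c ~[ ρ ] Poly.const c
~-const ρ ρ00 c =
  (refl , λ a → subst₂ ρ (sym (lookup-replicate a 0ℤ)) (sym (lookup-replicate a 0)) ρ00) ∷ []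

-- Used for the factor `scale M`: with exponents known to be exactly 0, multiplying by it keeps the
-- bound `l ≤ 1`.
BothZero : Correspondence
BothZero i l = i ≡ 0ℤ × l ≡ 0

-- The bound excludes cases such as exponent 2 in the CNF part against 0 in the IOR part, where the
-- square cancels but the difference is not zero.
ExponentImage : (ℕ → ℤ) → Correspondence
ExponentImage g i l = l ≤ 1 × i ≡ g l

~-mapExponents : {S : Fin n → Set} (g : ℕ → ℤ) → ∀ {p} → SquarefreeIn S p →
                 mapExponents g p ~[ ExponentImage g ] p
~-mapExponents g []                   = []
~-mapExponents g (_∷_ {x = t} s ss) =
  (refl , λ a → ExponentIn⇒≤1 (s a) , lookup-map a g (proj₂ t)) ∷ ~-mapExponents g ss

VanishTogether : Correspondence
VanishTogether i l = i ≡ 0ℤ ⇔ cancelSquares l ≡ 0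

-- Matched terms have equal coefficients, and their exponent vectors vanish together, so the Boolean
-- tests in `coeff` agree and the sums are equal summand by summand.
constantTerm-~ : {p : LaurentPolynomial n} {q : Polynomial n} → p ~[ VanishTogether ] q →
                 Laurent.constantTerm p ≡ Poly.constantTerm (idempotentLaw q)
constantTerm-~ []                                        = refl
constantTerm-~ (_∷_ {x = c , u} {y = _ , w} (refl , h) hs) =
  cong₂ (λ b d → (if b then c else 0ℚ) ℚ.+ d)
    (does-⇔ vanish (≡-dec ℤ._≟_ u Laurent.one) (≡-dec ℕ._≟_ (Vec.map cancelSquares w) Poly.one))
    (constantTerm-~ hs)
  where
  vanish : u ≡ Laurent.one ⇔ Vec.map cancelSquares w ≡ Poly.one
  vanish = mk⇔
    (λ u≡ → ≡replicate λ a →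
      trans (lookup-map a cancelSquares w) (Equivalence.to (h a) (≡replicate⁻ u≡ a)))
    (λ w≡ → ≡replicate λ a →
      Equivalence.from (h a) (trans (sym (lookup-map a cancelSquares w)) (≡replicate⁻ w≡ a)))

-- Four cases for exponents in {0, 1}: when they are equal, the difference is 0 and the sum 0 or 2
-- cancels; when they differ, the difference is 1 or -1 and the sum 1 survives.
vanish-+ : ∀ {i l j m} → ExponentImage +_ i l → ExponentImage (λ l → ℤ.- (+ l)) j m →
           VanishTogether (i ℤ.+ j) (l ℕ.+ m)
vanish-+ (ℕ.z≤n       , refl) (ℕ.z≤n       , refl) = mk⇔ (λ _ → refl) (λ _ → refl)
vanish-+ (ℕ.z≤n       , refl) (ℕ.s≤s ℕ.z≤n , refl) = mk⇔ (λ ()) (λ ())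
vanish-+ (ℕ.s≤s ℕ.z≤n , refl) (ℕ.z≤n       , refl) = mk⇔ (λ ()) (λ ())
vanish-+ (ℕ.s≤s ℕ.z≤n , refl) (ℕ.s≤s ℕ.z≤n , refl) = mk⇔ (λ _ → refl) (λ _ → refl)

relaxation~elementary : ∀ {M N} (φ : CNF M N) →
                        relaxationByInverse φ ~[ VanishTogether ] elementaryExpression φ
relaxation~elementary {M} φ =
  Pointwise.++⁺
    (~-* (ExponentImage +_) (ExponentImage (λ l → ℤ.- (+ l))) VanishTogether vanish-+
      (~-* BothZero (ExponentImage +_) (ExponentImage +_)
        (λ { (refl , refl) (m≤1 , j≡) → m≤1 , trans (ℤ.+-identityˡ _) j≡ })
        (~-const BothZero (refl , refl) (scale M))
        (~-mapExponents +_ (proj₂ (P-squarefree φ))))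
      (~-mapExponents (λ l → ℤ.- (+ l)) (proj₂ (Q-squarefree φ))))
    (~-const VanishTogether (mk⇔ (λ _ → refl) (λ _ → refl)) (ℚ.- 1ℚ))

-- Cancellation of squares and of inverse pairs, and the conclusion.

cancelSquares-double : ∀ l → cancelSquares (l ℕ.+ l) ≡ 0
cancelSquares-double zero    = refl
cancelSquares-double (suc l) =
  trans (cong (cancelSquares ∘ suc) (ℕ.+-suc l l)) (cancelSquares-double l)

square-cancels : (v : Vec ℕ n) → Vec.map cancelSquares (Vec.zipWith ℕ._+_ v v) ≡ Poly.one
square-cancels v = ≡replicate λ a →
  trans (lookup-map a cancelSquares (Vec.zipWith ℕ._+_ v v))
    (trans (cong cancelSquares (lookup-zipWith ℕ._+_ a v v))
      (cancelSquares-double (Vec.lookup v a)))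

inverse-cancels : (v : Vec ℕ n) →
  Vec.zipWith ℤ._+_ (Vec.map +_ v) (Vec.map (λ l → ℤ.- (+ l)) v) ≡ Laurent.one
inverse-cancels v = ≡replicate λ a →
  trans (lookup-zipWith ℤ._+_ a (Vec.map +_ v) _)
    (trans (cong₂ ℤ._+_ (lookup-map a +_ v) (lookup-map a (λ l → ℤ.- (+ l)) v))
      (ℤ.+-inverseʳ (+ Vec.lookup v a)))

mainTheorem13 : ∀ {M N : ℕ} (φ : CNF M N) → (∀ (i : Fin N) → 1 ≤ r φ i) →
    (∀ (a : Fin (M * 3)) →
    (idempotentLaw (X a Poly.* X a) Poly.≈ Poly.const 1ℚ)
    × (toLaurent (X a) Laurent.* atInverses (X a) Laurent.≈ Laurent.const 1ℚ))
    × (Laurent.constantTerm (relaxationByInverse φ)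
    ≡ Poly.constantTerm (idempotentLaw (elementaryExpression φ)))
mainTheorem13 φ _ =
  (λ a →
    -- A product of two one-term sums is one term, and its coefficient computes to `1ℚ`, so only the
    -- exponent vector has to be rewritten.
    (λ m → cong (λ v → Poly.coeff m ((1ℚ , v) ∷ [])) (square-cancels (Poly.one Vec.[ a ]≔ 1))) ,
    (λ m → cong (λ v → Laurent.coeff m ((1ℚ , v) ∷ [])) (inverse-cancels (Poly.one Vec.[ a ]≔ 1)))) ,
  constantTerm-~ (relaxation~elementary φ)
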